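{- Let $(A_n)_{n\ge1},(B_n)_{n\ge1},(C_n)_{n\ge1},(D_n)_{n\ge1}$ be the sequences associated with the anti-Tribonacci sequence $(D_n)$. Then for all $n\ge 1$: $$0\le 10n-6-3A_n\le 2,$$ $$0\le 10n-2-3B_n\le 3,$$ $$0\le 10n+1-3C_n\le 3,$$ $$0\le 10n-3-D_n\le 2.$$
   Context: For a set $S$ of positive integers, $\mathrm{mex}(S)$ denotes the smallest positive integer not in $S$. The sequences are defined recursively as follows: $A_1=1$, $B_1=2$, $C_1=3$, $D_1=6$, and for $n\ge 1$, with $S_n=\{A_i,B_i,C_i,D_i: 1\le i\le n\}$, one sets $A_{n+1}=\mathrm{mex}(S_n)$, $B_{n+1}=\mathrm{mex}(S_n\cup\{A_{n+1}\})$, $C_{n+1}=\mathrm{mex}(S_n\cup\{A_{n+1},B_{n+1}\})$, and $D_{n+1}=A_{n+1}+B_{n+1}+C_{n+1}$. The $D_n$ are the anti-Tribonacci numbers $6,16,27,36,46,57,66,75,87,96,\ldots$ (OEIS A265389). -}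

module Defs where

open import Data.List using (List; []; _∷_; _++_)
open import Data.List.Extrema.Nat using (max; xs≤max)
open import Data.List.Membership.DecPropositional using (_∈?_)
open import Data.List.Membership.Propositional using (_∈_; _∉_)
open import Data.List.Relation.Unary.All using (lookup)
open import Data.Nat using (ℕ; zero; suc; _+_; _≤_; _<_; _≥_; s≤s; z≤n; _≟_)
open import Data.Nat.Properties using (+-comm; +-suc; 1+n≰n; ≮⇒≥; m<1+n⇒m<n∨m≡n; m≤n⇒m≤1+n)
open import Data.Sum using (inj₁; inj₂)
open import Relation.Binary.PropositionalEquality using (refl; sym; subst)
open import Relation.Nullary using (yes; no)

-- Finite sets of positive integers are represented by lists; only membership
-- matters.
record IsMex (S : List ℕ) (m : ℕ) : Set where
  field
    positive : m ≥ 1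
    fresh    : m ∉ S
    least    : ∀ {k} → k ≥ 1 → k ∉ S → m ≤ k

-- The first of k, k + 1, …, k + fuel that is not in S (k + fuel if there is
-- no earlier one).
searchFrom : (fuel k : ℕ) → List ℕ → ℕ
searchFrom zero       k S = k
searchFrom (suc fuel) k S with _∈?_ _≟_ k S
... | yes _ = searchFrom fuel (suc k) S
... | no  _ = k

-- The candidates 1, …, max S + 1 suffice, as max S + 1 is not in S.
mex : List ℕ → ℕ
mex S = searchFrom (max 0 S) 1 S

searchFrom-isMex : ∀ fuel k S → k ≥ 1 → (∀ {j} → j ≥ 1 → j < k → j ∈ S) →
                   fuel + k ∉ S → IsMex S (searchFrom fuel k S)
searchFrom-isMex zero k S k≥1 below end = record
  { positive = k≥1
  ; fresh    = end
  ; least    = λ j≥1 j∉S → ≮⇒≥ λ j<k → j∉S (below j≥1 j<k)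
  }
searchFrom-isMex (suc fuel) k S k≥1 below end with _∈?_ _≟_ k S
... | no k∉S = record
  { positive = k≥1
  ; fresh    = k∉S
  ; least    = λ j≥1 j∉S → ≮⇒≥ λ j<k → j∉S (below j≥1 j<k)
  }
... | yes k∈S = searchFrom-isMex fuel (suc k) S (m≤n⇒m≤1+n k≥1) below′
                  (subst (_∉ S) (sym (+-suc fuel k)) end)
  where
  below′ : ∀ {j} → j ≥ 1 → j < suc k → j ∈ S
  below′ j≥1 j<1+k with m<1+n⇒m<n∨m≡n j<1+k
  ... | inj₁ j<k  = below j≥1 j<k
  ... | inj₂ refl = k∈S

mex-isMex : ∀ S → IsMex S (mex S)
mex-isMex S = searchFrom-isMex (max 0 S) 1 S (s≤s z≤n)
  (λ { (s≤s _) (s≤s ()) })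
  (subst (_∉ S) (+-comm 1 (max 0 S)) λ m∈S → 1+n≰n (lookup (xs≤max 0 S) m∈S))

-- The sequences are indexed from 1; the values at index 0 are junk and do not
-- enter any S n.
A B C D : ℕ → ℕ

-- S n = {A i, B i, C i, D i : 1 ≤ i ≤ n}
S : ℕ → List ℕ
S zero    = []
S (suc n) = S n ++ A (suc n) ∷ B (suc n) ∷ C (suc n) ∷ D (suc n) ∷ []

A 0             = 0
A 1             = 1
A (suc (suc n)) = mex (S (suc n))

B 0             = 0
B 1             = 2
B (suc (suc n)) = mex (S (suc n) ++ A (suc (suc n)) ∷ [])

C 0             = 0
C 1             = 3
C (suc (suc n)) = mex (S (suc n) ++ A (suc (suc n)) ∷ B (suc (suc n)) ∷ [])

D 0             = 0
D 1             = 6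
D (suc (suc n)) = A (suc (suc n)) + B (suc (suc n)) + C (suc (suc n))

{-# OPTIONS --safe #-}
-- The values A 1, B 1, C 1, A 2, B 2, C 2, … enumerate increasingly the
-- positive integers that are not values of D, so the k-th of them is k + d,
-- where d counts the values of D below it. Assuming 10i − 5 ≤ D i ≤ 10i − 3 for
-- the earlier values of D, the inequalities D d < k + d < D (d + 1) give
-- 9d − 4 ≤ k ≤ 9d + 6. For k = 3n + 1, 3n + 2, 3n + 3 this confines the errors
-- of A, B, C at n + 1 to the intervals claimed; summed, with integrality, they
-- yield the bounds on the next value of D.
module Submission where

open import Defs using (A; B; C; D; S; IsMex; mex-isMex)
open import Data.Integer using (+_; _*_; _+_; _-_; _≤_; +≤+)
import Data.Integer.Properties as ℤ
import Data.Integer.Tactic.RingSolver as ℤRing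
open import Data.List using (List; []; _∷_; _++_)
open import Data.List.Membership.DecPropositional using (_∈?_)
open import Data.List.Membership.Propositional using (_∈_; _∉_)
open import Data.List.Membership.Propositional.Properties using (∈-++⁺ˡ; ∈-++⁺ʳ; ∈-++⁻)
open import Data.List.Properties using (++-assoc)
open import Data.List.Relation.Unary.Any using (here)
open import Data.Nat using (ℕ; zero; suc; _<_; _≥_; z≤n; s≤s; s≤s⁻¹; _≟_)
import Data.Nat as ℕ
open import Data.Nat.Properties
open import Data.Nat.Tactic.RingSolver using (solve)
open import Data.Product using (_×_; _,_; proj₁; proj₂; ∃-syntax)
open import Data.Sum using (_⊎_; inj₁; inj₂)
open import Relation.Binary.PropositionalEquality
  using (_≡_; refl; sym; trans; cong; cong₂; subst; subst₂)
open import Relation.Nullary using (yes; no; contradiction)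

-- Spacing of the values of `D`

record Near (i x : ℕ) : Set where
  constructor near
  field
    upper : 3 ℕ.+ x ℕ.≤ 10 ℕ.* i
    lower : 10 ℕ.* i ℕ.≤ 5 ℕ.+ x

NearUpTo : (ℕ → ℕ) → ℕ → Set
NearUpTo f n = ∀ {i} → i ≥ 1 → i ℕ.≤ n → Near i (f i)

-- Windows of width 2 repeated with period 10 are far apart. In particular no two values are
-- adjacent integers, so a mex has to skip at most one of them.
near-gap : ∀ {i j x y} → i < j → Near i x → Near j y → suc x < y
near-gap {i} {j} {x} {y} i<j (near x≤ _) (near _ ≤y) = +-cancelˡ-≤ 5 _ _ (begin
  7 ℕ.+ x          ≤⟨ m≤n+m (7 ℕ.+ x) 6 ⟩
  10 ℕ.+ (3 ℕ.+ x) ≤⟨ +-monoʳ-≤ 10 x≤ ⟩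
  10 ℕ.+ 10 ℕ.* i  ≡⟨ *-suc 10 i ⟨
  10 ℕ.* suc i     ≤⟨ *-monoʳ-≤ 10 i<j ⟩
  10 ℕ.* j         ≤⟨ ≤y ⟩
  5 ℕ.+ y          ∎)
  where open ≤-Reasoning

-- Enumerating non-values by successive mex

mex-unique : ∀ {T a m} → IsMex T a → m ≥ 1 → m ∉ T →
             (∀ {x} → x ≥ 1 → x < m → x ∈ T) → a ≡ m
mex-unique isMex m≥1 m∉T below =
  ≤-antisym (least m≥1 m∉T) (≮⇒≥ λ a<m → fresh (below positive a<m))
  where open IsMex isMex

-- T consists of 1, …, m and of the values f i > m with i ≤ n. The values f i ≤ m
-- are those with 1 ≤ i ≤ d; the other k elements of {1, …, m} are not among
-- f 1, …, f n. When f d is near 10d, passed is what f d < m yields.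
record Sweep (f : ℕ → ℕ) (n : ℕ) (T : List ℕ) (k m d : ℕ) : Set where
  field
    d≤n     : d ℕ.≤ n
    count   : m ≡ k ℕ.+ d
    passed  : 10 ℕ.* d ℕ.≤ 4 ℕ.+ m
    covered : ∀ {x} → x ≥ 1 → x ℕ.≤ m → x ∈ T
    split   : ∀ {x} → x ∈ T → x ℕ.≤ m ⊎ ∃[ i ] d < i × i ℕ.≤ n × x ≡ f i
    pending : ∀ {i} → d < i → i ℕ.≤ n → f i ∈ T × m < f i

-- If `suc m` is free, it is the mex and `d` stays. Otherwise `suc m` is a pending value, which the
-- spacing forces to be `f (suc d)`; the spacing also keeps `suc (suc m)` free, so that is the mex
-- and one more value is passed.
sweep-step : ∀ {f n T k m d a} → NearUpTo f n → Sweep f n T k m d → IsMex T a →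
             ∃[ d′ ] Sweep f n (T ++ a ∷ []) (suc k) a d′
sweep-step {f} {n} {T} {k} {m} {d} {a} nearf sw isMex with _∈?_ _≟_ (suc m) T
... | no m+1∉T with refl ← mex-unique isMex (s≤s z≤n) m+1∉T
                             (λ x≥1 x<1+m → Sweep.covered sw x≥1 (s≤s⁻¹ x<1+m)) = d , record
  { d≤n     = d≤n
  ; count   = cong suc count
  ; passed  = m≤n⇒m≤1+n passed
  ; covered = λ x≥1 x≤ → case-covered x≥1 (m≤n⇒m<n∨m≡n x≤)
  ; split   = λ x∈ → case-split (∈-++⁻ T x∈)
  ; pending = λ d<i i≤n → let fi∈T , m<fi = pending d<i i≤n in
      ∈-++⁺ˡ fi∈T , ≤∧≢⇒< m<fi (λ { eq → m+1∉T (subst (_∈ T) (sym eq) fi∈T) })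
  }
  where
  open Sweep sw
  case-covered : ∀ {x} → x ≥ 1 → x < suc m ⊎ x ≡ suc m → x ∈ T ++ suc m ∷ []
  case-covered x≥1 (inj₁ x<1+m) = ∈-++⁺ˡ (covered x≥1 (s≤s⁻¹ x<1+m))
  case-covered x≥1 (inj₂ refl)  = ∈-++⁺ʳ T (here refl)
  case-split : ∀ {x} → x ∈ T ⊎ x ∈ suc m ∷ [] →
               x ℕ.≤ suc m ⊎ ∃[ i ] d < i × i ℕ.≤ n × x ≡ f i
  case-split (inj₂ (here refl)) = inj₁ ≤-refl
  case-split (inj₁ x∈T) with split x∈T
  ... | inj₁ x≤m = inj₁ (m≤n⇒m≤1+n x≤m)
  ... | inj₂ p   = inj₂ p
... | yes m+1∈T with Sweep.split sw m+1∈T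
...   | inj₁ m<m = contradiction m<m 1+n≰n
...   | inj₂ (i , d<i , i≤n , m+1≡fi) = suc d , subst new (sym a≡) record
  { d≤n     = d<n
  ; count   = cong suc (trans (cong suc count) (sym (+-suc k d)))
  -- With `f (suc d)` equal to `suc m`, the bound `10 * suc d ≤ 5 + f (suc d)` becomes
  -- `10 * suc d ≤ 4 + suc (suc m)`.
  ; passed  = subst (10 ℕ.* suc d ℕ.≤_) (cong (5 ℕ.+_) (sym m+1≡f))
                (Near.lower near-next)
  ; covered = λ x≥1 x≤ → case-covered x≥1 (m≤n⇒m<n∨m≡n x≤)
  ; split   = λ x∈ → case-split (∈-++⁻ T x∈)
  ; pending = λ 1+d<j j≤n → ∈-++⁺ˡ (proj₁ (pending (<-trans (n<1+n d) 1+d<j) j≤n))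
      , beyond 1+d<j j≤n
  }
  where
  open Sweep sw
  new : ℕ → Set
  new b = Sweep f n (T ++ b ∷ []) (suc k) b (suc d)
  d<n : d < n
  d<n = ≤-trans d<i i≤n
  near-next : Near (suc d) (f (suc d))
  near-next = nearf (s≤s z≤n) d<n
  m+1≡f : suc m ≡ f (suc d)
  m+1≡f with m≤n⇒m<n∨m≡n d<i
  ... | inj₂ refl  = m+1≡fi
  -- Were `i` beyond `suc d`, then `m < f (suc d)` and the gap after `f (suc d)` would push `f i`
  -- above `suc m`.
  ... | inj₁ 1+d<i = contradiction
    (<-trans (s≤s (proj₂ (pending (n<1+n d) d<n)))
      (near-gap 1+d<i near-next (nearf (m<n⇒0<n d<i) i≤n)))
    (<-irrefl m+1≡fi)
  beyond : ∀ {j} → suc d < j → j ℕ.≤ n → suc (suc m) < f j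
  beyond {j} 1+d<j j≤n = subst (λ v → suc v < f j) (sym m+1≡f)
    (near-gap 1+d<j near-next (nearf (m<n⇒0<n 1+d<j) j≤n))
  covered′ : ∀ {x} → x ≥ 1 → x < suc (suc m) → x ∈ T
  covered′ x≥1 x<2+m with m≤n⇒m<n∨m≡n (s≤s⁻¹ x<2+m)
  ... | inj₁ x<1+m = covered x≥1 (s≤s⁻¹ x<1+m)
  ... | inj₂ refl  = m+1∈T
  m+2∉T : suc (suc m) ∉ T
  m+2∉T m+2∈T with split m+2∈T
  ... | inj₁ 2+m≤m = contradiction (<⇒≤ 2+m≤m) 1+n≰n
  ... | inj₂ (j , d<j , j≤n , m+2≡fj) with m≤n⇒m<n∨m≡n d<j
  ...   | inj₂ refl  = contradiction (trans m+2≡fj (sym m+1≡f)) 1+n≢n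
  ...   | inj₁ 1+d<j = <-irrefl m+2≡fj (beyond 1+d<j j≤n)
  a≡ : a ≡ suc (suc m)
  a≡ = mex-unique isMex (s≤s z≤n) m+2∉T covered′
  case-covered : ∀ {x} → x ≥ 1 → x < suc (suc m) ⊎ x ≡ suc (suc m) →
                 x ∈ T ++ suc (suc m) ∷ []
  case-covered x≥1 (inj₁ x<2+m) = ∈-++⁺ˡ (covered′ x≥1 x<2+m)
  case-covered x≥1 (inj₂ refl)  = ∈-++⁺ʳ T (here refl)
  case-split : ∀ {x} → x ∈ T ⊎ x ∈ suc (suc m) ∷ [] →
               x ℕ.≤ suc (suc m) ⊎ ∃[ j ] suc d < j × j ℕ.≤ n × x ≡ f j
  case-split (inj₂ (here refl)) = inj₁ ≤-refl
  case-split (inj₁ x∈T) with split x∈T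
  ... | inj₁ x≤m = inj₁ (m≤n⇒m≤1+n (m≤n⇒m≤1+n x≤m))
  ... | inj₂ (j , d<j , j≤n , x≡fj) with m≤n⇒m<n∨m≡n d<j
  ...   | inj₂ refl  = inj₁ (m≤n⇒m≤1+n (≤-reflexive (trans x≡fj (sym m+1≡f))))
  ...   | inj₁ 1+d<j = inj₂ (j , 1+d<j , j≤n , x≡fj)

sweep-extend : ∀ {f n T k m d} → Sweep f n T k m d → m < f (suc n) →
               Sweep f (suc n) (T ++ f (suc n) ∷ []) k m d
sweep-extend {f} {n} {T} {m = m} {d} sw m<f = record
  { d≤n     = m≤n⇒m≤1+n d≤n
  ; count   = count
  ; passed  = passed
  ; covered = λ x≥1 x≤m → ∈-++⁺ˡ (covered x≥1 x≤m)
  ; split   = λ x∈ → case-split (∈-++⁻ T x∈)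
  ; pending = λ d<i i≤1+n → case-pending d<i (m≤n⇒m<n∨m≡n i≤1+n)
  }
  where
  open Sweep sw
  case-split : ∀ {x} → x ∈ T ⊎ x ∈ f (suc n) ∷ [] →
               x ℕ.≤ m ⊎ ∃[ i ] d < i × i ℕ.≤ suc n × x ≡ f i
  case-split (inj₂ (here refl)) = inj₂ (suc n , s≤s d≤n , ≤-refl , refl)
  case-split (inj₁ x∈T) with split x∈T
  ... | inj₁ x≤m                    = inj₁ x≤m
  ... | inj₂ (i , d<i , i≤n , x≡fi) = inj₂ (i , d<i , m≤n⇒m≤1+n i≤n , x≡fi)
  case-pending : ∀ {i} → d < i → i < suc n ⊎ i ≡ suc n →
                 f i ∈ T ++ f (suc n) ∷ [] × m < f i
  case-pending d<i (inj₂ refl)  = ∈-++⁺ʳ T (here refl) , m<f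
  case-pending d<i (inj₁ i<1+n) =
    let fi∈T , m<fi = pending d<i (s≤s⁻¹ i<1+n) in ∈-++⁺ˡ fi∈T , m<fi

-- Bounds on the number of values passed, and on the errors

sweep-lower : ∀ {f n T k m d} → Sweep f n T k m d → 9 ℕ.* d ℕ.≤ 4 ℕ.+ k
sweep-lower {k = k} {m} {d} sw = +-cancelʳ-≤ d _ _ (begin
  9 ℕ.* d ℕ.+ d   ≡⟨ +-comm (9 ℕ.* d) d ⟩
  10 ℕ.* d        ≤⟨ passed ⟩
  4 ℕ.+ m         ≡⟨ cong (4 ℕ.+_) count ⟩
  4 ℕ.+ k ℕ.+ d   ∎)
  where open ≤-Reasoning
        open Sweep sw

sweep-upper : ∀ {f n T k m d} → NearUpTo f n → Sweep f n T k m d →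
              k ℕ.≤ 3 ℕ.+ 3 ℕ.* n → k ℕ.≤ 6 ℕ.+ 9 ℕ.* d
sweep-upper {f} {k = k} {m} {d} nearf sw k≤ with m≤n⇒m<n∨m≡n (Sweep.d≤n sw)
-- No value is pending when `d` is `n`, so the bound comes from `k ≤ 3 + 3n`; otherwise it comes
-- from `m < f (suc d)`.
... | inj₂ refl = ≤-trans k≤
  (+-mono-≤ (m≤m+n 3 3) (*-monoˡ-≤ d (m≤m+n 3 6)))
... | inj₁ d<n = +-cancelˡ-≤ (4 ℕ.+ d) _ _ (begin
  4 ℕ.+ d ℕ.+ k                 ≡⟨ solve (d ∷ k ∷ []) ⟩
  4 ℕ.+ (k ℕ.+ d)               ≡⟨ cong (4 ℕ.+_) count ⟨
  3 ℕ.+ suc m                   ≤⟨ +-monoʳ-≤ 3 (proj₂ (pending (n<1+n d) d<n)) ⟩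
  3 ℕ.+ f (suc d)               ≤⟨ Near.upper (nearf (s≤s z≤n) d<n) ⟩
  10 ℕ.* suc d                  ≡⟨ solve (d ∷ []) ⟩
  4 ℕ.+ d ℕ.+ (6 ℕ.+ 9 ℕ.* d)   ∎)
  where
  open ≤-Reasoning
  open Sweep sw

-- Holds since `2 + 3 * y < 3 * suc y`. This is where integrality enters.
third-≤ : ∀ {x y} → 3 ℕ.* x ℕ.≤ 2 ℕ.+ 3 ℕ.* y → x ℕ.≤ y
third-≤ {x} {y} le = s≤s⁻¹ (*-cancelˡ-< 3 x (suc y)
  (≤-trans (s≤s le) (≤-reflexive (sym (*-suc 3 y)))))

-- The claimed inequalities, with terms moved across so that they live in ℕ. The one for `D` is
-- `Near`, which the induction feeds back.
record Bounds (n a b c x : ℕ) : Set where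
  field
    boundA : 6 ℕ.+ 3 ℕ.* a ℕ.≤ 10 ℕ.* n × 10 ℕ.* n ℕ.≤ 6 ℕ.+ 3 ℕ.* a ℕ.+ 2
    boundB : 2 ℕ.+ 3 ℕ.* b ℕ.≤ 10 ℕ.* n × 10 ℕ.* n ℕ.≤ 2 ℕ.+ 3 ℕ.* b ℕ.+ 3
    boundC : 3 ℕ.* c ℕ.≤ 10 ℕ.* n ℕ.+ 1 × 10 ℕ.* n ℕ.+ 1 ℕ.≤ 3 ℕ.* c ℕ.+ 3
    boundD : Near n x

shift-≤ : ∀ {p q x y} c → p ℕ.≤ q → x ≡ c ℕ.+ p → c ℕ.+ q ≡ y → x ℕ.≤ y
shift-≤ c p≤q refl refl = +-monoʳ-≤ c p≤q

-- p, q, r count the values of D below a, b, c.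
bounds : ∀ n {a b c} p q r →
  a ≡ 1 ℕ.+ 3 ℕ.* n ℕ.+ p → b ≡ 2 ℕ.+ 3 ℕ.* n ℕ.+ q → c ≡ 3 ℕ.+ 3 ℕ.* n ℕ.+ r →
  3 ℕ.* p ℕ.≤ 1 ℕ.+ n → 3 ℕ.* q ℕ.≤ 2 ℕ.+ n → 3 ℕ.* r ℕ.≤ 2 ℕ.+ n →
  n ℕ.≤ 1 ℕ.+ 3 ℕ.* p → n ℕ.≤ 1 ℕ.+ 3 ℕ.* q → n ℕ.≤ 1 ℕ.+ 3 ℕ.* r →
  Bounds (suc n) a b c (a ℕ.+ b ℕ.+ c)
bounds n p q r refl refl refl p≤ q≤ r≤ ≤p ≤q ≤r = record
  { boundA = shift-≤ (9 ℕ.+ 9 ℕ.* n) p≤ (solve (n ∷ p ∷ [])) (solve (n ∷ []))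
           , shift-≤ (10 ℕ.+ 9 ℕ.* n) ≤p (solve (n ∷ [])) (solve (n ∷ p ∷ []))
  ; boundB = shift-≤ (8 ℕ.+ 9 ℕ.* n) q≤ (solve (n ∷ q ∷ [])) (solve (n ∷ []))
           , shift-≤ (10 ℕ.+ 9 ℕ.* n) ≤q (solve (n ∷ [])) (solve (n ∷ q ∷ []))
  ; boundC = shift-≤ (9 ℕ.+ 9 ℕ.* n) r≤ (solve (n ∷ r ∷ [])) (solve (n ∷ []))
           , shift-≤ (11 ℕ.+ 9 ℕ.* n) ≤r (solve (n ∷ [])) (solve (n ∷ r ∷ []))
  ; boundD = near
      (shift-≤ (9 ℕ.+ 9 ℕ.* n) sum≤ (solve (n ∷ p ∷ q ∷ r ∷ [])) (solve (n ∷ [])))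
      (shift-≤ (10 ℕ.+ 9 ℕ.* n) ≤sum (solve (n ∷ [])) (solve (n ∷ p ∷ q ∷ r ∷ [])))
  }
  where
  sum≤ : p ℕ.+ q ℕ.+ r ℕ.≤ 1 ℕ.+ n
  -- The three upper bounds add up to `5 + 3 * n`, which is `2 + 3 * (1 + n)`: rounding removes the
  -- excess 2.
  sum≤ = third-≤ (shift-≤ 0 (+-mono-≤ (+-mono-≤ p≤ q≤) r≤)
    (solve (p ∷ q ∷ r ∷ [])) (solve (n ∷ [])))
  ≤sum : n ℕ.≤ 1 ℕ.+ (p ℕ.+ q ℕ.+ r)
  ≤sum = third-≤ (m≤n⇒m≤1+n (m≤n⇒m≤1+n (shift-≤ 0 (+-mono-≤ (+-mono-≤ ≤p ≤q) ≤r)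
    (solve (n ∷ [])) (solve (p ∷ q ∷ r ∷ [])))))

sweep-count-≤ : ∀ {f n T k m d} y → Sweep f n T k m d →
                4 ℕ.+ k ℕ.≤ 2 ℕ.+ 3 ℕ.* y → 3 ℕ.* d ℕ.≤ y
sweep-count-≤ {d = d} y sw k≤ = third-≤
  (≤-trans (≤-reflexive (sym (*-assoc 3 3 d))) (≤-trans (sweep-lower sw) k≤))

-- Combining `1 + 3n ≤ k` with `k ≤ 6 + 9d` gives `3n ≤ 2 + 3(1 + 3d)`, to be divided by 3.
sweep-count-≥ : ∀ {f n T k m d} → NearUpTo f n → Sweep f n T k m d →
                1 ℕ.+ 3 ℕ.* n ℕ.≤ k → k ℕ.≤ 3 ℕ.+ 3 ℕ.* n → n ℕ.≤ 1 ℕ.+ 3 ℕ.* d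
sweep-count-≥ {n = n} {d = d} nearf sw ≤k k≤ = third-≤
  (≤-trans (s≤s⁻¹ (≤-trans ≤k (sweep-upper nearf sw k≤))) (≤-reflexive (solve (d ∷ []))))

-- Induction along the four sequences

-- The prescribed 1, 2, 3 are themselves the mex of the empty set, {1} and {1, 2}, so the induction
-- can start from the empty set at `n = 0`.
A-isMex : ∀ n → IsMex (S n) (A (suc n))
A-isMex zero    = mex-isMex _
A-isMex (suc n) = mex-isMex _

B-isMex : ∀ n → IsMex (S n ++ A (suc n) ∷ []) (B (suc n))
B-isMex zero    = mex-isMex _
B-isMex (suc n) = mex-isMex _

C-isMex : ∀ n → IsMex (S n ++ A (suc n) ∷ B (suc n) ∷ []) (C (suc n))
C-isMex zero    = mex-isMex _
C-isMex (suc n) = mex-isMex _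

D-sum : ∀ n → D (suc n) ≡ A (suc n) ℕ.+ B (suc n) ℕ.+ C (suc n)
D-sum zero    = refl
D-sum (suc n) = refl

record Stage (n : ℕ) : Set where
  constructor stage
  field
    nearD   : NearUpTo D n
    {m d}   : ℕ
    sweep   : Sweep D n (S n) (3 ℕ.* n) m d

-- Three sweep steps yield `A`, `B`, `C`; their counts bound the new value of `D`, which then joins
-- the pending values.
next : ∀ {n} → Stage n →
       Bounds (suc n) (A (suc n)) (B (suc n)) (C (suc n)) (D (suc n)) × Stage (suc n)
next {n} (stage nearD sweep₀)
  with p , sweepA ← sweep-step nearD sweep₀ (A-isMex n)
  with q , sweepB ← sweep-step nearD sweepA (B-isMex n)
  with r , sweepC ← sweep-step nearD sweepB
         (subst (λ T → IsMex T (C (suc n))) (sym (++-assoc (S n) _ _)) (C-isMex n))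
  = boundsₙ , stage (λ i≥1 i≤ → nearD′ i≥1 (m≤n⇒m<n∨m≡n i≤)) sweepD
  where
  a = A (suc n)
  b = B (suc n)
  c = C (suc n)
  boundsₙ : Bounds (suc n) a b c (D (suc n))
  boundsₙ = subst (Bounds (suc n) a b c) (sym (D-sum n)) (bounds n p q r
    (Sweep.count sweepA) (Sweep.count sweepB) (Sweep.count sweepC)
    (sweep-count-≤ (1 ℕ.+ n) sweepA (≤-reflexive (solve (n ∷ []))))
    -- Here `2 + 3 * (2 + n)` exceeds `4 + k` by 2, and for `C` by 1; for `A`, with `1 + n`, there
    -- is equality.
    (sweep-count-≤ (2 ℕ.+ n) sweepB
      (shift-≤ (6 ℕ.+ 3 ℕ.* n) (z≤n {2}) (solve (n ∷ [])) (solve (n ∷ []))))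
    (sweep-count-≤ (2 ℕ.+ n) sweepC
      (shift-≤ (7 ℕ.+ 3 ℕ.* n) (z≤n {1}) (solve (n ∷ [])) (solve (n ∷ []))))
    (sweep-count-≥ nearD sweepA ≤-refl (m≤n+m _ 2))
    (sweep-count-≥ nearD sweepB (m≤n+m _ 1) (m≤n+m _ 1))
    (sweep-count-≥ nearD sweepC (m≤n+m _ 2) ≤-refl))
  nearD′ : ∀ {i} → i ≥ 1 → i < suc n ⊎ i ≡ suc n → Near i (D i)
  nearD′ i≥1 (inj₁ i<1+n) = nearD i≥1 (s≤s⁻¹ i<1+n)
  nearD′ i≥1 (inj₂ refl)  = Bounds.boundD boundsₙ
  c<D : c < D (suc n)
  c<D = subst (c <_) (sym (D-sum n))
    -- `a ≥ 1` makes `a + b + c` exceed `c`.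
    (+-monoˡ-≤ c (≤-trans (IsMex.positive (A-isMex n)) (m≤m+n a b)))
  flatten : (((S n ++ a ∷ []) ++ b ∷ []) ++ c ∷ []) ++ D (suc n) ∷ [] ≡ S (suc n)
  flatten = trans (++-assoc ((S n ++ a ∷ []) ++ b ∷ []) _ _)
    (trans (++-assoc (S n ++ a ∷ []) _ _) (++-assoc (S n) _ _))
  sweepD : Sweep D (suc n) (S (suc n)) (3 ℕ.* suc n) c r
  sweepD = subst₂ (λ T k → Sweep D (suc n) T k c r) flatten (sym (*-suc 3 n))
    (sweep-extend sweepC c<D)

stages : ∀ n → Stage n
stages zero    = stage (λ { (s≤s _) () }) {0} {0} record
  { d≤n     = z≤n
  ; count   = refl
  ; passed  = z≤n
  ; covered = λ { (s≤s _) () }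
  ; split   = λ ()
  ; pending = λ { (s≤s _) () }
  }
stages (suc n) = proj₂ (next (stages n))

-- Passage to the integers

-- As `y ≤ x`, the integer difference is the truncated one, so bounds in ℕ transfer.
difference-bounds : ∀ {x y} z e → z ≡ + x - + y → y ℕ.≤ x → x ℕ.≤ y ℕ.+ e →
                    + 0 ≤ z × z ≤ + e
difference-bounds {x} {y} z e refl y≤x x≤y+e
  rewrite ℤ.m-n≡m⊖n x y | ℤ.⊖-≥ y≤x =
    +≤+ z≤n , +≤+ (m≤n+o⇒m∸n≤o x y x≤y+e)

sub-sub : ∀ x y z → x - y - z ≡ x - (y + z)
sub-sub = ℤRing.solve-∀

collect : ∀ n u v → + 10 * + n - + u - + 3 * + v ≡ + (10 ℕ.* n) - + (u ℕ.+ 3 ℕ.* v)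
collect n u v = trans (sub-sub (+ 10 * + n) (+ u) (+ 3 * + v))
  (cong₂ (λ x y → x - (+ u + y)) (sym (ℤ.pos-* 10 n)) (sym (ℤ.pos-* 3 v)))

mainTheorem4 : (n : ℕ) → n ≥ 1 →
    (+ 0 ≤ + 10 * + n - + 6 - + 3 * + A n × + 10 * + n - + 6 - + 3 * + A n ≤ + 2)
    × (+ 0 ≤ + 10 * + n - + 2 - + 3 * + B n × + 10 * + n - + 2 - + 3 * + B n ≤ + 3)
    × (+ 0 ≤ + 10 * + n + + 1 - + 3 * + C n × + 10 * + n + + 1 - + 3 * + C n ≤ + 3)
    × (+ 0 ≤ + 10 * + n - + 3 - + D n × + 10 * + n - + 3 - + D n ≤ + 2)
mainTheorem4 (suc n) _ =
    difference-bounds _ 2 (collect (suc n) 6 (A (suc n))) (proj₁ boundA) (proj₂ boundA)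
  , difference-bounds _ 3 (collect (suc n) 2 (B (suc n))) (proj₁ boundB) (proj₂ boundB)
  , difference-bounds _ 3 eqC (proj₁ boundC) (proj₂ boundC)
  , difference-bounds _ 2 eqD (Near.upper boundD)
      (subst (10 ℕ.* suc n ℕ.≤_) (+-comm 2 (3 ℕ.+ D (suc n))) (Near.lower boundD))
  where
  open Bounds (proj₁ (next (stages n)))
  eqC : + 10 * + suc n + + 1 - + 3 * + C (suc n) ≡
        + (10 ℕ.* suc n ℕ.+ 1) - + (3 ℕ.* C (suc n))
  eqC = cong₂ (λ x y → x + + 1 - y) (sym (ℤ.pos-* 10 (suc n))) (sym (ℤ.pos-* 3 (C (suc n))))
  eqD : + 10 * + suc n - + 3 - + D (suc n) ≡ + (10 ℕ.* suc n) - + (3 ℕ.+ D (suc n))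
  eqD = trans (sub-sub (+ 10 * + suc n) (+ 3) (+ D (suc n)))
    (cong (_- + (3 ℕ.+ D (suc n))) (sym (ℤ.pos-* 10 (suc n))))
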